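{- Let $G$ be a unicyclic non-König-Egerváry graph with unique cycle $C$. Then $$\ker(G)=\bigcup\{\ker(T_x): x\in N_1(C)\}=\mathrm{core}(G).$$
   Context: All graphs are finite, simple and undirected (no loops, no multiple edges). A graph $G$ is unicyclic if it is connected and contains exactly one cycle, denoted $C$, with vertex set $V(C)$. For a vertex $v$, $N(v)$ is the set of vertices adjacent to $v$, and $N(A)=\bigcup_{v\in A}N(v)$ for a set $A$ of vertices. Let $N_1(C)=\{v\in V(G)\setminus V(C): N(v)\cap V(C)\ne\emptyset\}$. For $x\in N_1(C)$, with $y\in V(C)$ its neighbor on the cycle, $T_x$ is the connected component (a tree) containing $x$ of the graph $G-xy$ obtained by deleting the edge $xy$. A set of vertices is independent if no two of its vertices are adjacent; $\alpha(G)$ is the maximum size of an independent set, and $\Omega(G)$ is the family of all maximum independent sets. $\mathrm{core}(G)=\bigcap\{S:S\in\Omega(G)\}$. $\mu(G)$ is the maximum size of a matching. $G$ is a König-Egerváry graph if $\alpha(G)+\mu(G)=|V(G)|$, and a non-König-Egerváry graph otherwise. For a graph $H$ and $X\subseteq V(H)$, let $d(X)=|X|-|N(X)|$ (neighborhoods taken in $H$). An independent set $A$ of $H$ is a critical independent set if $d(A)=\max\{d(I): I \text{ an independent set of } H\}$ (the empty set is allowed). $\ker(H)$ is the intersection of all critical independent sets of $H$. In the claim, $\ker(T_x)$ is computed in the graph $T_x$. An empty union is the empty set. -}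

module Defs where

open import Data.Fin.Base using (Fin; zero; suc; inject₁; fromℕ)
open import Data.Fin.Properties using (_≟_; any?)
open import Data.Fin.Subset using (Subset; _∈_; _⊆_; _⊃_; ∣_∣; ⁅_⁆; _∪_)
open import Data.Fin.Subset.Induction using (⊃-wellFounded)
open import Data.Fin.Subset.Properties
  using (_∈?_; x∈⁅x⁆; x∈⁅y⁆⇒x≡y; p⊆p∪q; q⊆p∪q; x∈p∪q⁻)
open import Data.Integer.Base as ℤ using (ℤ; +_)
open import Data.List.Base using (List; length)
open import Data.List.Relation.Unary.All using (All)
open import Data.List.Relation.Unary.AllPairs using (AllPairs)
open import Data.Nat.Base as ℕ using (ℕ; _+_)
open import Data.Product using (∃; ∃₂; _×_; _,_)
open import Data.Sum.Base using (_⊎_; inj₁; inj₂)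
open import Data.Vec.Base using (tabulate)
open import Function.Base using (_∘_)
open import Function.Definitions using (Injective)
open import Induction.WellFounded using (Acc; acc)
open import Level using (0ℓ)
open import Relation.Binary.Construct.Closure.ReflexiveTransitive
  using (Star; ε; _◅_; _◅◅_)
open import Relation.Binary.Core using (Rel; _⇔_)
open import Relation.Binary.Definitions using (Decidable; Symmetric)
open import Relation.Binary.PropositionalEquality
  using (_≡_; _≢_; refl)
open import Relation.Nullary
  using (¬_; yes; no; does; _×-dec_; _⊎-dec_; ¬?)
open import Relation.Nullary.Decidable using (map′; decidable-stable)
import Relation.Unary as U

-- The vertex set is a subset of Fin n rather than all of Fin n, so that the
-- subgraphs of a graph live over the same ambient Fin n.
record Graph (n : ℕ) : Set₁ where
  infix 4 _~_ _~?_
  field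
    V        : Subset n
    _~_      : Rel (Fin n) 0ℓ
    _~?_     : Decidable _~_
    ~-sym    : Symmetric _~_
    ~-irrefl : ∀ {v} → ¬ v ~ v
    ~⇒∈V     : ∀ {u v} → u ~ v → u ∈ V

private
  variable
    n : ℕ

subsetOf : {P : U.Pred (Fin n) 0ℓ} → U.Decidable P → Subset n
subsetOf P? = tabulate (does ∘ P?)

module _ (G : Graph n) where
  open Graph G

  N : Subset n → Subset n
  N X = subsetOf (λ v → any? (λ u → u ∈? X ×-dec u ~? v))

  Independent : Subset n → Set
  Independent X = X ⊆ V × (∀ {u v} → u ∈ X → v ∈ X → ¬ u ~ v)

  MaximumIndependent : Subset n → Set
  MaximumIndependent S =
    Independent S × (∀ S′ → Independent S′ → ∣ S′ ∣ ℕ.≤ ∣ S ∣)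

  core : U.Pred (Fin n) 0ℓ
  core v = ∀ S → MaximumIndependent S → v ∈ S

  d : Subset n → ℤ
  d X = + ∣ X ∣ ℤ.- + ∣ N X ∣

  CriticalIndependent : Subset n → Set
  CriticalIndependent A =
    Independent A × (∀ I → Independent I → d I ℤ.≤ d A)

  ker : U.Pred (Fin n) 0ℓ
  ker v = ∀ A → CriticalIndependent A → v ∈ A

DisjointEdges : Rel (Fin n × Fin n) 0ℓ
DisjointEdges (u , v) (u′ , v′) = u ≢ u′ × u ≢ v′ × v ≢ u′ × v ≢ v′

module _ (G : Graph n) where
  open Graph G

  -- A matching lists each of its edges once, in one of the two orientations;
  -- repetitions are excluded since an edge is not disjoint from itself.
  Matching : List (Fin n × Fin n) → Set
  Matching M = All (λ (u , v) → u ~ v) M × AllPairs DisjointEdges M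

  MaximumMatching : List (Fin n × Fin n) → Set
  MaximumMatching M =
    Matching M × (∀ M′ → Matching M′ → length M′ ℕ.≤ length M)

  IsIndependenceNumber : ℕ → Set
  IsIndependenceNumber α = ∃ λ S → MaximumIndependent G S × ∣ S ∣ ≡ α

  IsMatchingNumber : ℕ → Set
  IsMatchingNumber μ = ∃ λ M → MaximumMatching M × length M ≡ μ

  KönigEgerváry : Set
  KönigEgerváry = ∃₂ λ α μ →
    IsIndependenceNumber α × IsMatchingNumber μ × α + μ ≡ ∣ V ∣

-- i ↝ j : j follows i in the cyclic order of Fin (suc m).
data _↝_ {m : ℕ} : Rel (Fin (ℕ.suc m)) 0ℓ where
  step : (i : Fin m) → inject₁ i ↝ suc i
  wrap : fromℕ m ↝ zero

record Cycle (G : Graph n) : Set where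
  open Graph G
  field
    k         : ℕ
    vertex    : Fin (3 + k) → Fin n
    injective : Injective _≡_ _≡_ vertex
    adjacent  : ∀ {i j} → i ↝ j → vertex i ~ vertex j

module _ {G : Graph n} where

  VertexOf : Cycle G → U.Pred (Fin n) 0ℓ
  VertexOf C v = ∃ λ i → Cycle.vertex C i ≡ v

  EdgeOf : Cycle G → Rel (Fin n) 0ℓ
  EdgeOf C u v = ∃₂ λ i j → i ↝ j ×
    ((vertex i ≡ u × vertex j ≡ v) ⊎ (vertex i ≡ v × vertex j ≡ u))
    where open Cycle C

  -- A Cycle carries a starting point and a direction; two of them are the same
  -- cycle of G when they have the same edges.
  SameCycle : Rel (Cycle G) 0ℓ
  SameCycle C C′ = EdgeOf C ⇔ EdgeOf C′

Connected : Graph n → Set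
Connected G = ∀ {u v} → u ∈ V → v ∈ V → Star _~_ u v
  where open Graph G

record Unicyclic (G : Graph n) : Set where
  field
    connected : Connected G
    cycle     : Cycle G
    unique    : ∀ C → SameCycle C cycle

deleteEdge : Graph n → Fin n → Fin n → Graph n
deleteEdge G x y = record
  { V        = V
  ; _~_      = λ u v → u ~ v × ¬ IsXY u v
  ; _~?_     = λ u v → u ~? v ×-dec
      ¬? ((u ≟ x ×-dec v ≟ y) ⊎-dec (u ≟ y ×-dec v ≟ x))
  ; ~-sym    = λ (u~v , ≢xy) → ~-sym u~v , λ vu → ≢xy (IsXY-sym vu)
  ; ~-irrefl = λ (v~v , _) → ~-irrefl v~v
  ; ~⇒∈V     = λ (u~v , _) → ~⇒∈V u~v
  }
  where
  open Graph G
  IsXY : Rel (Fin _) 0ℓ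
  IsXY u v = (u ≡ x × v ≡ y) ⊎ (u ≡ y × v ≡ x)

  IsXY-sym : ∀ {u v} → IsXY u v → IsXY v u
  IsXY-sym (inj₁ (u≡x , v≡y)) = inj₂ (v≡y , u≡x)
  IsXY-sym (inj₂ (u≡y , v≡x)) = inj₁ (v≡x , u≡y)

module _ (G : Graph n) where
  open Graph G

  private
    -- Grow a set of vertices reachable from u until it is closed under _~_.
    closure : ∀ u S → Acc _⊃_ S → u ∈ S → (∀ {v} → v ∈ S → Star _~_ u v) →
              ∃ λ S′ → u ∈ S′ × (∀ {v} → v ∈ S′ → Star _~_ u v) ×
                       (∀ {v w} → v ∈ S′ → v ~ w → w ∈ S′)
    closure u S (acc rs) u∈S reach
      with any? (λ w → ¬? (w ∈? S) ×-dec any? (λ v → v ∈? S ×-dec v ~? w))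
    ... | yes (w , w∉S , v , v∈S , v~w) =
      closure u (S ∪ ⁅ w ⁆)
        (rs (p⊆p∪q ⁅ w ⁆ , w , q⊆p∪q S ⁅ w ⁆ (x∈⁅x⁆ w) , w∉S))
        (p⊆p∪q ⁅ w ⁆ u∈S) reach′
      where
      reach′ : ∀ {z} → z ∈ S ∪ ⁅ w ⁆ → Star _~_ u z
      reach′ z∈ with x∈p∪q⁻ S ⁅ w ⁆ z∈
      ... | inj₁ z∈S = reach z∈S
      ... | inj₂ z∈w with refl ← x∈⁅y⁆⇒x≡y w z∈w = reach v∈S ◅◅ v~w ◅ ε
    ... | no none = S , u∈S , reach , λ {v} {w} v∈S v~w →
      decidable-stable (w ∈? S) λ w∉S → none (w , w∉S , v , v∈S , v~w)

  reachable? : Decidable (Star _~_)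
  reachable? u v
    with closure u ⁅ u ⁆ (⊃-wellFounded ⁅ u ⁆) (x∈⁅x⁆ u)
           (λ v∈ → start (x∈⁅y⁆⇒x≡y u v∈))
    where
    start : ∀ {v} → v ≡ u → Star _~_ u v
    start refl = ε
  ... | S , u∈S , reach , closed = map′ reach (follow u∈S) (v ∈? S)
    where
    follow : ∀ {w} → w ∈ S → Star _~_ w v → v ∈ S
    follow w∈S ε             = w∈S
    follow w∈S (w~z ◅ z⟶v) = follow (closed w∈S w~z) z⟶v

  component : Fin n → Graph n
  component x = record
    { V        = W
    ; _~_      = λ u v → u ~ v × u ∈ W × v ∈ W
    ; _~?_     = λ u v → u ~? v ×-dec u ∈? W ×-dec v ∈? W
    ; ~-sym    = λ (u~v , u∈W , v∈W) → ~-sym u~v , v∈W , u∈W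
    ; ~-irrefl = λ (v~v , _) → ~-irrefl v~v
    ; ~⇒∈V     = λ (_ , u∈W , _) → u∈W
    }
    where
    W : Subset n
    W = subsetOf (λ v → v ∈? V ×-dec reachable? x v)

module _ (G : Graph n) (C : Cycle G) where
  open Graph G

  N₁ : U.Pred (Fin n) 0ℓ
  N₁ x = x ∈ V × ¬ VertexOf C x × ∃ λ y → x ~ y × VertexOf C y

  T : Fin n → Fin n → Graph n
  T x y = component (deleteEdge G x y) x

  -- When C is the only cycle, x ∈ N₁ has exactly one neighbour y on C.
  ⋃kerT : U.Pred (Fin n) 0ℓ
  ⋃kerT v = ∃₂ λ x y → N₁ x × x ~ y × VertexOf C y × ker (T x y) v

{-# OPTIONS --safe #-}
module Submission where

-- For y on the cycle C the graph G - y is a forest, and a forest F satisfies α(F) + μ(F) = |V(F)|.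
-- Since G is not König-Egerváry, a maximum independent set of G - y - x is still maximum in G for
-- every edge xy with y on C. Hence core(G) misses C, and a maximum independent set I of G avoiding x
-- and y can be cut along xy: I ∩ V(T_x) is maximum in T_x, and may be replaced by any other maximum
-- independent set of T_x. This gives core(G) ⊆ ⋃ core(T_x), where core(T_x) ⊆ ker(T_x) by counting
-- along a maximum matching of T_x - v. If A is critical in G, then so is A ∩ I, and A ∩ I ∩ V(T_x) is
-- critical in T_x, giving ker(T_x) ⊆ ker(G). Finally ker(G) ⊆ core(G) because intersecting an
-- independent set with a maximum one does not decrease d.

open import Defs
open import Data.Bool.Base using (true; false)
open import Data.Empty using (⊥-elim)
open import Data.Fin.Base using (Fin; zero; suc; inject₁; fromℕ; toℕ)
open import Data.Fin.Properties using (_≟_; any?; injective⇒≤; toℕ-injective)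
open import Data.Fin.Relation.Unary.Top using (view; ‵fromℕ; ‵inj₁)
open import Data.Fin.Subset
  using (Subset; _∈_; _∉_; _⊆_; ∣_∣; ⁅_⁆; _∪_; _∩_; _─_; _-_)
open import Data.Fin.Subset.Properties
open import Data.Integer.Base as ℤ using (ℤ)
import Data.Integer.Properties as ℤ
open import Data.Integer.Tactic.RingSolver using () renaming (solve-∀ to ℤ-solve-∀)
open import Data.List.Base using (List; []; _∷_; length)
open import Data.List.Relation.Unary.All as All using (All; []; _∷_)
open import Data.List.Relation.Unary.AllPairs using (AllPairs; []; _∷_)
open import Data.Nat.Base using (ℕ; zero; suc; _+_; _≤_; _<_; z≤n; s≤s; s≤s⁻¹)
open import Data.Nat.Properties hiding (_≟_)
open import Data.Nat.Tactic.RingSolver using (solve-∀)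
open import Data.Product using (∃; ∃₂; Σ; _×_; _,_; proj₁; proj₂)
open import Data.Sum.Base using (_⊎_; inj₁; inj₂)
open import Data.Vec.Base using ([]; _∷_)
open import Data.Vec.Properties using ([]=⇒lookup; lookup⇒[]=; lookup∘tabulate)
open import Function.Base using (_∘_; id)
open import Level using (0ℓ)
open import Relation.Binary.Construct.Closure.ReflexiveTransitive
  using (Star; ε; _◅_; _◅◅_)
open import Relation.Binary.Core using (Rel)
open import Relation.Binary.PropositionalEquality
open import Relation.Nullary using (¬_; yes; no; does; _×-dec_; ¬?)
open import Relation.Nullary.Decidable using (decidable-stable; dec-true)
import Relation.Unary as U
open import Relation.Unary using (_≐_)

open Graph using (V) renaming
  (_~_ to Adj; _~?_ to adj?; ~-sym to Adj-sym; ~-irrefl to Adj-irrefl; ~⇒∈V to Adj⇒∈V)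

private
  variable
    n m : ℕ
    u v w x y z : Fin n

-- Cardinalities of finite subsets.

Disjoint : Subset n → Subset n → Set
Disjoint p q = ∀ {x} → x ∈ p → x ∉ q

∣p∪q∣+∣p∩q∣≡∣p∣+∣q∣ : ∀ (p q : Subset n) → ∣ p ∪ q ∣ + ∣ p ∩ q ∣ ≡ ∣ p ∣ + ∣ q ∣
∣p∪q∣+∣p∩q∣≡∣p∣+∣q∣ []          []          = refl
∣p∪q∣+∣p∩q∣≡∣p∣+∣q∣ (true  ∷ p) (true  ∷ q) =
  cong suc (trans (+-suc _ _) (trans (cong suc (∣p∪q∣+∣p∩q∣≡∣p∣+∣q∣ p q)) (sym (+-suc _ _))))
∣p∪q∣+∣p∩q∣≡∣p∣+∣q∣ (true  ∷ p) (false ∷ q) = cong suc (∣p∪q∣+∣p∩q∣≡∣p∣+∣q∣ p q)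
∣p∪q∣+∣p∩q∣≡∣p∣+∣q∣ (false ∷ p) (true  ∷ q) =
  trans (cong suc (∣p∪q∣+∣p∩q∣≡∣p∣+∣q∣ p q)) (sym (+-suc _ _))
∣p∪q∣+∣p∩q∣≡∣p∣+∣q∣ (false ∷ p) (false ∷ q) = ∣p∪q∣+∣p∩q∣≡∣p∣+∣q∣ p q

Disjoint⇒∣p∪q∣≡∣p∣+∣q∣ : ∀ (p q : Subset n) → Disjoint p q → ∣ p ∪ q ∣ ≡ ∣ p ∣ + ∣ q ∣
Disjoint⇒∣p∪q∣≡∣p∣+∣q∣ {n} p q p⊥q = begin
  ∣ p ∪ q ∣              ≡⟨ +-identityʳ _ ⟨
  ∣ p ∪ q ∣ + 0          ≡⟨ cong (∣ p ∪ q ∣ +_) (trans (cong ∣_∣ p∩q≡⊥) (∣⊥∣≡0 n)) ⟨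
  ∣ p ∪ q ∣ + ∣ p ∩ q ∣  ≡⟨ ∣p∪q∣+∣p∩q∣≡∣p∣+∣q∣ p q ⟩
  ∣ p ∣ + ∣ q ∣          ∎
  where
  open ≡-Reasoning
  p∩q≡⊥ = Empty-unique {p = p ∩ q} λ (x , x∈) →
    let x∈p , x∈q = x∈p∩q⁻ p q x∈ in p⊥q x∈p x∈q

x∈p─q⁻ : ∀ (p q : Subset n) → x ∈ p ─ q → x ∈ p × x ∉ q
x∈p─q⁻ p q x∈ = p─q⊆p p q x∈ , go p q x∈
  where
  go : ∀ {n} {x : Fin n} (p q : Subset n) → x ∈ p ─ q → x ∉ q
  go {x = zero}  (_ ∷ _) (false ∷ _) _  = λ ()
  go {x = zero}  (_ ∷ _) (true  ∷ _) ()
  go {x = suc _} (_ ∷ p) (_ ∷ q)     x∈ = go p q (drop-there x∈) ∘ drop-there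

x∈p-y⁻ : ∀ (p : Subset n) y → x ∈ p - y → x ∈ p × x ≢ y
x∈p-y⁻ p y x∈ = let x∈p , x∉y = x∈p─q⁻ p ⁅ y ⁆ x∈ in x∈p , x∉⁅y⁆⇒x≢y x∉y

∣p∩q∣+∣p─q∣≡∣p∣ : ∀ (p q : Subset n) → ∣ p ∩ q ∣ + ∣ p ─ q ∣ ≡ ∣ p ∣
∣p∩q∣+∣p─q∣≡∣p∣ []          []          = refl
∣p∩q∣+∣p─q∣≡∣p∣ (true  ∷ p) (true  ∷ q) = cong suc (∣p∩q∣+∣p─q∣≡∣p∣ p q)
∣p∩q∣+∣p─q∣≡∣p∣ (true  ∷ p) (false ∷ q) = trans (+-suc _ _) (cong suc (∣p∩q∣+∣p─q∣≡∣p∣ p q))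
∣p∩q∣+∣p─q∣≡∣p∣ (false ∷ p) (true  ∷ q) = ∣p∩q∣+∣p─q∣≡∣p∣ p q
∣p∩q∣+∣p─q∣≡∣p∣ (false ∷ p) (false ∷ q) = ∣p∩q∣+∣p─q∣≡∣p∣ p q

∣p∪⁅x⁆∣≡1+∣p∣ : ∀ (p : Subset n) → x ∉ p → ∣ p ∪ ⁅ x ⁆ ∣ ≡ suc ∣ p ∣
∣p∪⁅x⁆∣≡1+∣p∣ {x = x} p x∉p = begin
  ∣ p ∪ ⁅ x ⁆ ∣      ≡⟨ Disjoint⇒∣p∪q∣≡∣p∣+∣q∣ p ⁅ x ⁆ (λ y∈p y∈x → x∉p (subst (_∈ p) (x∈⁅y⁆⇒x≡y x y∈x) y∈p)) ⟩
  ∣ p ∣ + ∣ ⁅ x ⁆ ∣  ≡⟨ cong (∣ p ∣ +_) (∣⁅x⁆∣≡1 x) ⟩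
  ∣ p ∣ + 1          ≡⟨ +-comm _ 1 ⟩
  suc ∣ p ∣          ∎
  where open ≡-Reasoning

x∈p⇒1+∣p-x∣≡∣p∣ : ∀ (p : Subset n) → x ∈ p → suc ∣ p - x ∣ ≡ ∣ p ∣
x∈p⇒1+∣p-x∣≡∣p∣ {x = x} p x∈p = begin
  suc ∣ p - x ∣              ≡⟨ cong (_+ ∣ p - x ∣) (∣⁅x⁆∣≡1 x) ⟨
  ∣ ⁅ x ⁆ ∣ + ∣ p - x ∣      ≡⟨ cong (λ q → ∣ q ∣ + ∣ p - x ∣) ⁅x⁆≡p∩⁅x⁆ ⟩
  ∣ p ∩ ⁅ x ⁆ ∣ + ∣ p - x ∣  ≡⟨ ∣p∩q∣+∣p─q∣≡∣p∣ p ⁅ x ⁆ ⟩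
  ∣ p ∣                      ∎
  where
  open ≡-Reasoning
  ⁅x⁆≡p∩⁅x⁆ : ⁅ x ⁆ ≡ p ∩ ⁅ x ⁆
  ⁅x⁆≡p∩⁅x⁆ = ⊆-antisym
    (λ y∈ → x∈p∩q⁺ (subst (_∈ p) (sym (x∈⁅y⁆⇒x≡y x y∈)) x∈p , y∈))
    (p∩q⊆q p ⁅ x ⁆)

subsetOf⁺ : {P : U.Pred (Fin n) 0ℓ} (P? : U.Decidable P) → P x → x ∈ subsetOf P?
subsetOf⁺ {x = x} P? Px = lookup⇒[]= x _ (trans (lookup∘tabulate _ x) (dec-true (P? x) Px))

subsetOf⁻ : {P : U.Pred (Fin n) 0ℓ} (P? : U.Decidable P) → x ∈ subsetOf P? → P x
subsetOf⁻ {x = x} P? x∈ with P? x | trans (sym (lookup∘tabulate (does ∘ P?) x)) ([]=⇒lookup x∈)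
... | yes Px | _ = Px

-- Neighbourhoods, and counting along a matching.

module _ (G : Graph n) where

  N⁺ : ∀ X → u ∈ X → Adj G u v → v ∈ N G X
  N⁺ X u∈X u~v = subsetOf⁺ (λ v → any? (λ u → u ∈? X ×-dec adj? G u v)) (_ , u∈X , u~v)

  N⁻ : ∀ X → v ∈ N G X → ∃ λ u → u ∈ X × Adj G u v
  N⁻ X = subsetOf⁻ (λ v → any? (λ u → u ∈? X ×-dec adj? G u v))

-- One end of a matching edge at a time. If u is in `A`, both sides of the hypothesis gain 2, from
-- `A` and `m` on the left and from `P` and `B` on the right; otherwise only `m` and `P` are sure to
-- grow.
remove-arc : ∀ (A P B : Subset n) → u ∈ P → (u ∈ A → v ∈ B) →
             ∣ A - u ∣ + m ≤ ∣ P - u ∣ + ∣ B - v ∣ → ∣ A ∣ + suc m ≤ ∣ P ∣ + ∣ B ∣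
remove-arc {u = u} {v = v} {m = m} A P B u∈P A→B le with u ∈? A
... | yes u∈A = begin
  ∣ A ∣ + suc m                  ≡⟨ cong (_+ suc m) (x∈p⇒1+∣p-x∣≡∣p∣ A u∈A) ⟨
  suc (∣ A - u ∣ + suc m)        ≡⟨ cong suc (+-suc _ m) ⟩
  2 + (∣ A - u ∣ + m)            ≤⟨ +-monoʳ-≤ 2 le ⟩
  2 + (∣ P - u ∣ + ∣ B - v ∣)    ≡⟨ cong suc (+-suc ∣ P - u ∣ _) ⟨
  suc ∣ P - u ∣ + suc ∣ B - v ∣  ≡⟨ cong₂ _+_ (x∈p⇒1+∣p-x∣≡∣p∣ P u∈P) (x∈p⇒1+∣p-x∣≡∣p∣ B (A→B u∈A)) ⟩
  ∣ P ∣ + ∣ B ∣                  ∎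
  where open ≤-Reasoning
... | no u∉A = begin
  ∣ A ∣ + suc m                ≤⟨ +-monoˡ-≤ (suc m) (p⊆q⇒∣p∣≤∣q∣ {p = A} {q = A - u} (λ x∈A → x∈p∧x≢y⇒x∈p-y x∈A λ { refl → u∉A x∈A })) ⟩
  ∣ A - u ∣ + suc m            ≡⟨ +-suc _ m ⟩
  suc (∣ A - u ∣ + m)          ≤⟨ s≤s le ⟩
  suc ∣ P - u ∣ + ∣ B - v ∣    ≡⟨ cong (_+ ∣ B - v ∣) (x∈p⇒1+∣p-x∣≡∣p∣ P u∈P) ⟩
  ∣ P ∣ + ∣ B - v ∣            ≤⟨ +-monoʳ-≤ ∣ P ∣ (∣p─q∣≤∣p∣ B _) ⟩
  ∣ P ∣ + ∣ B ∣                ∎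
  where open ≤-Reasoning

-- Send each matched vertex to itself if it lies outside `A`, and to its partner in `B` otherwise.
-- This is injective into the disjoint sum of P - A and B, so 2|M| ≤ |P - A| + |B|. `B` is
-- arbitrary, not N(A), so that the induction can delete both ends of an edge from all three sets.
matching-bound : ∀ (M : List (Fin n × Fin n)) (A P B : Subset n) → A ⊆ P →
  All (λ (u , v) → u ≢ v × (u ∈ P × v ∈ P) × (u ∈ A → v ∈ B) × (v ∈ A → u ∈ B)) M →
  AllPairs DisjointEdges M → ∣ A ∣ + (length M + length M) ≤ ∣ P ∣ + ∣ B ∣
matching-bound []            A P B A⊆P []  [] = +-mono-≤ (p⊆q⇒∣p∣≤∣q∣ A⊆P) z≤n
matching-bound ((u , v) ∷ M) A P B A⊆P ((u≢v , (u∈P , v∈P) , A→B , A→B′) ∷ es) (ds ∷ dss)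
  rewrite +-suc (length M) (length M) =
  remove-arc A P B u∈P A→B
    (remove-arc (A - u) (P - u) (B - v) (keep v∈P (u≢v ∘ sym))
      (λ v∈A → keep (A→B′ (proj₁ (x∈p-y⁻ A u v∈A))) u≢v)
      (matching-bound M (A - u - v) (P - u - v) (B - v - u)
        (λ x∈ → let x∈A , x≢u , x≢v = out A x∈ in keep (keep (A⊆P x∈A) x≢u) x≢v)
        (All.zipWith (λ ((u≢a , u≢b , v≢a , v≢b) , a≢b , (a∈P , b∈P) , f , g) →
            a≢b ,
            (keep (keep a∈P (u≢a ∘ sym)) (v≢a ∘ sym) , keep (keep b∈P (u≢b ∘ sym)) (v≢b ∘ sym)) ,
            (λ a∈A → keep (keep (f (proj₁ (out A a∈A))) (v≢b ∘ sym)) (u≢b ∘ sym)) ,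
            (λ b∈A → keep (keep (g (proj₁ (out A b∈A))) (v≢a ∘ sym)) (u≢a ∘ sym)))
          (ds , es))
        dss))
  where
  keep : ∀ {p : Subset _} {a b} → a ∈ p → a ≢ b → a ∈ p - b
  keep = x∈p∧x≢y⇒x∈p-y
  out : ∀ (p : Subset _) {a} → a ∈ p - u - v → a ∈ p × a ≢ u × a ≢ v
  out p a∈ = let a∈′ , a≢v = x∈p-y⁻ (p - u) v a∈ ; a∈p , a≢u = x∈p-y⁻ p u a∈′ in a∈p , a≢u , a≢v

-- Cycles and simple paths.

mapCycle : {H G : Graph n} → (∀ {u v} → Adj H u v → Adj G u v) → Cycle H → Cycle G
mapCycle f C = record
  { k = Cycle.k C ; vertex = vertex ; injective = injective ; adjacent = f ∘ adjacent }
  where open Cycle C using (vertex; injective; adjacent)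

successor : (i : Fin (suc m)) → ∃ (i ↝_)
successor i with view i
... | ‵fromℕ         = zero , wrap
... | ‵inj₁ {i = j} _ = suc j , step j

module _ (R : Rel (Fin n) 0ℓ) where

  -- Simple paths; the number counts edges.
  data Path : Fin n → Fin n → ℕ → Set
  at : Path u v m → Fin (suc m) → Fin n

  data Path where
    []   : Path u u 0
    cons : R u v → (p : Path v w m) → (∀ i → at p i ≢ u) → Path u w (suc m)

  at ([] {u})             _       = u
  at (cons {u} _ _ _)     zero    = u
  at (cons     _ p _)     (suc i) = at p i

  at-first : (p : Path u v m) → at p zero ≡ u
  at-first []           = refl
  at-first (cons _ _ _) = refl

  at-last : (p : Path u v m) → at p (fromℕ m) ≡ v
  at-last []           = refl
  at-last (cons _ p _) = at-last p

  at-injective : (p : Path u v m) → ∀ {i j} → at p i ≡ at p j → i ≡ j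
  at-injective []            {zero}  {zero}  _  = refl
  at-injective (cons _ _ _)  {zero}  {zero}  _  = refl
  at-injective (cons _ _ u∉) {zero}  {suc j} eq = ⊥-elim (u∉ j (sym eq))
  at-injective (cons _ _ u∉) {suc i} {zero}  eq = ⊥-elim (u∉ i eq)
  at-injective (cons _ p _)  {suc i} {suc j} eq = cong suc (at-injective p eq)

  at-step : (p : Path u v m) (i : Fin m) → R (at p (inject₁ i)) (at p (suc i))
  at-step (cons r p _) zero    rewrite at-first p = r
  at-step (cons _ p _) (suc i) = at-step p i

  length<n : Path u v m → m < n
  length<n p = injective⇒≤ (at-injective p)

  -- The second component carries the induction: it hands the simplicity condition of `p` down to
  -- the prefix.
  prefix : (p : Path u v m) (i : Fin (suc m)) →
           Σ (Path u (at p i) (toℕ i)) λ q → ∀ j → ∃ λ l → at q j ≡ at p l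
  prefix []            zero    = [] , λ _ → zero , refl
  prefix (cons _ _ _)  zero    = [] , λ _ → zero , refl
  prefix (cons r p u∉) (suc i) =
    let q , q⊆p = prefix p i in
    cons r q (λ j eq → let l , eq′ = q⊆p j in u∉ l (trans (sym eq′) eq)) ,
    λ { zero    → zero , refl
      ; (suc j) → let l , eq = q⊆p j in suc l , eq }

  suffix : (p : Path u v m) (i : Fin (suc m)) → ∃ (Path (at p i) v)
  suffix []             zero    = _ , []
  suffix p@(cons _ _ _) zero    = _ , p
  suffix (cons _ p _)   (suc i) = suffix p i

  -- Loop erasure: if u already lies on the path obtained from the rest of the walk, only the part
  -- from that occurrence on is kept.
  Star⇒Path : Star R u v → ∃ (Path u v)
  Star⇒Path ε               = 0 , []
  Star⇒Path {u = u} (r ◅ s) with Star⇒Path s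
  ... | m , p with any? (λ i → at p i ≟ u)
  ...   | yes (i , refl) = suffix p i
  ...   | no u∉p         = suc m , cons r p λ i eq → u∉p (i , eq)

  -- At least two edges are required because a cycle needs three vertices; the path supplies the
  -- `step` edges and v~u the `wrap` edge.
  closePath : (G : Graph n) → (∀ {u v} → R u v → Adj G u v) →
              Path u v (2 + m) → Adj G v u → Cycle G
  closePath {m = m} G R⇒G p v~u = record
    { k = m ; vertex = at p ; injective = at-injective p
    ; adjacent = λ
      { (step i) → R⇒G (at-step p i)
      ; wrap     → subst₂ (Adj G) (sym (at-last p)) (sym (at-first p)) v~u } }

-- Vertices of degree at most one in a forest.

module _ (G : Graph n) (acyclic : ¬ Cycle G) where

  private
    -- A neighbour of the first vertex at position 2 or later would close a cycle with the prefix
    -- ending there.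
    position : (p : Path (Adj G) u v m) (i : Fin (suc m)) → Adj G u (at (Adj G) p i) → toℕ i ≡ 1
    position {u = u} p zero u~u =
      ⊥-elim (Adj-irrefl G (subst (Adj G u) (at-first (Adj G) p) u~u))
    position p (suc zero)          _   = refl
    position p i@(suc (suc _)) u~i = ⊥-elim
      (acyclic (closePath (Adj G) G id (proj₁ (prefix (Adj G) p i)) (Adj-sym G u~i)))

    -- A longest path starts at a vertex of degree at most one.
    extend : ∀ f → m + f ≡ n → Path (Adj G) u v m → u ∈ V G →
             ∃ λ ℓ → ℓ ∈ V G × (∀ {w z} → Adj G ℓ w → Adj G ℓ z → w ≡ z)
    -- `f` counts the extensions still possible: a path with n edges would have n + 1 distinct
    -- vertices.
    extend {m = m} zero eq p _ =
      ⊥-elim (<-irrefl (trans (sym (+-identityʳ m)) eq) (length<n (Adj G) p))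
    extend {m = m} {u = u} (suc f) eq p u∈V
      with any? (λ w → adj? G u w ×-dec ¬? (any? λ i → at (Adj G) p i ≟ w))
    ... | yes (w , u~w , w∉p) =
      extend f (trans (sym (+-suc m f)) eq)
        (cons (Adj-sym G u~w) p λ i eq′ → w∉p (i , eq′)) (Adj⇒∈V G (Adj-sym G u~w))
    -- All neighbours of u now lie on the path, hence all at position 1.
    ... | no none = u , u∈V , λ u~w u~z →
      let i , eqᵢ = on-path u~w
          j , eqⱼ = on-path u~z
          i≡j = toℕ-injective (trans (position p i (subst (Adj G u) (sym eqᵢ) u~w))
                                (sym (position p j (subst (Adj G u) (sym eqⱼ) u~z))))
      in trans (sym eqᵢ) (trans (cong (at (Adj G) p) i≡j) eqⱼ)
      where
      on-path : Adj G u w → ∃ λ i → at (Adj G) p i ≡ w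
      on-path {w} u~w = decidable-stable (any? λ i → at (Adj G) p i ≟ w)
        λ w∉p → none (w , u~w , w∉p)

  low-degree-vertex : u ∈ V G → ∃ λ ℓ → ℓ ∈ V G × (∀ {w z} → Adj G ℓ w → Adj G ℓ z → w ≡ z)
  low-degree-vertex {u = u} = extend n refl ([] {u = u})

-- Vertex deletion, and tight pairs in forests.

infixl 6 _∖_

_∖_ : Graph n → Fin n → Graph n
G ∖ x = record
  { V        = V G - x
  ; _~_      = λ u v → Adj G u v × u ≢ x × v ≢ x
  ; _~?_     = λ u v → adj? G u v ×-dec ¬? (u ≟ x) ×-dec ¬? (v ≟ x)
  ; ~-sym    = λ (u~v , u≢x , v≢x) → Adj-sym G u~v , v≢x , u≢x
  ; ~-irrefl = λ (u~u , _) → Adj-irrefl G u~u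
  ; ~⇒∈V     = λ (u~v , u≢x , _) → x∈p∧x≢y⇒x∈p-y (Adj⇒∈V G u~v) u≢x
  }

map-Matching : (H G : Graph n) → (∀ {u v} → Adj H u v → Adj G u v) →
               ∀ {M} → Matching H M → Matching G M
map-Matching H G f (es , ds) = All.map f es , ds

cons-Matching : (G : Graph n) {M : List (Fin n × Fin n)} →
                Adj G x y → Matching (G ∖ x ∖ y) M → Matching G ((x , y) ∷ M)
cons-Matching G x~y (es , ds) =
  x~y ∷ All.map (proj₁ ∘ proj₁) es ,
  All.map (λ ((_ , u≢x , v≢x) , u≢y , v≢y) → (u≢x ∘ sym) , (v≢x ∘ sym) , (u≢y ∘ sym) , (v≢y ∘ sym)) es ∷ ds

∪-Independent : (G : Graph n) {A B : Subset n} → Independent G A → Independent G B →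
                (∀ {u v} → u ∈ A → v ∈ B → ¬ Adj G u v) → Independent G (A ∪ B)
∪-Independent G {A} {B} (A⊆V , A-indep) (B⊆V , B-indep) A≁B = ⊆V , indep
  where
  ⊆V : A ∪ B ⊆ V G
  ⊆V u∈ with x∈p∪q⁻ A B u∈
  ... | inj₁ u∈A = A⊆V u∈A
  ... | inj₂ u∈B = B⊆V u∈B
  indep : u ∈ A ∪ B → v ∈ A ∪ B → ¬ Adj G u v
  indep u∈ v∈ with x∈p∪q⁻ A B u∈ | x∈p∪q⁻ A B v∈
  ... | inj₁ u∈A | inj₁ v∈A = A-indep u∈A v∈A
  ... | inj₁ u∈A | inj₂ v∈B = A≁B u∈A v∈B
  ... | inj₂ u∈B | inj₁ v∈A = A≁B v∈A u∈B ∘ Adj-sym G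
  ... | inj₂ u∈B | inj₂ v∈B = B-indep u∈B v∈B

insert-Independent : (G : Graph n) {I : Subset n} → Independent G I → x ∈ V G →
                     (∀ {u} → u ∈ I → ¬ Adj G x u) → Independent G (I ∪ ⁅ x ⁆)
insert-Independent {x = x} G I-indep x∈V x≁I = ∪-Independent G I-indep
  ((λ u∈ → subst (_∈ V G) (sym (≡x u∈)) x∈V) ,
   λ u∈ v∈ u~v → Adj-irrefl G (subst₂ (Adj G) (≡x u∈) (≡x v∈) u~v))
  λ u∈I v∈ u~v → x≁I u∈I (Adj-sym G (subst (Adj G _) (≡x v∈) u~v))
  where
  ≡x : u ∈ ⁅ x ⁆ → u ≡ x
  ≡x = x∈⁅y⁆⇒x≡y x

∖⁻-Independent : (G : Graph n) {I : Subset n} → Independent (G ∖ x) I → Independent G I × x ∉ I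
∖⁻-Independent {x = x} G {I} (I⊆ , indep) =
  (proj₁ ∘ out , λ u∈I v∈I u~v → indep u∈I v∈I (u~v , proj₂ (out u∈I) , proj₂ (out v∈I))) ,
  λ x∈I → proj₂ (out x∈I) refl
  where
  out : u ∈ I → u ∈ V G × u ≢ x
  out u∈I = x∈p-y⁻ (V G) x (I⊆ u∈I)

-- A set and a matching witnessing α(G) + μ(G) = |V(G)|.
record Tight (G : Graph n) : Set where
  field
    I           : Subset n
    M           : List (Fin n × Fin n)
    independent : Independent G I
    matching    : Matching G M
    tight       : ∣ I ∣ + length M ≡ ∣ V G ∣

-- Induction on a bound `f` for the number of vertices. A vertex ℓ of degree at most one always goes
-- into `I`; if it has a neighbour w, both are deleted and the edge ℓw goes into `M`.
acyclic⇒Tight : (G : Graph n) → ¬ Cycle G → Tight G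
acyclic⇒Tight {n} G = go ∣ V G ∣ G ≤-refl
  where
  go : ∀ f (G : Graph n) → ∣ V G ∣ ≤ f → ¬ Cycle G → Tight G
  go f G V≤f acyclic with nonempty? (V G)
  ... | no empty = record
    { I = V G ; M = [] ; independent = id , (λ u∈ _ _ → empty (_ , u∈))
    ; matching = [] , [] ; tight = +-identityʳ _ }
  go zero    G V≤0 acyclic | yes (u , u∈V) with () ← subst (_≤ 0) (sym (x∈p⇒1+∣p-x∣≡∣p∣ (V G) u∈V)) V≤0
  go (suc f) G V≤f acyclic | yes (u , u∈V)
    with low-degree-vertex G acyclic u∈V
  ... | ℓ , ℓ∈V , one with any? (λ w → adj? G ℓ w)
  ...   | no isolated = record
    { I = I ∪ ⁅ ℓ ⁆ ; M = M
    ; independent = insert-Independent G I-indep ℓ∈V (λ {w} _ ℓ~w → isolated (w , ℓ~w))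
    ; matching = map-Matching (G ∖ ℓ) G proj₁ matching
    ; tight = trans (cong (_+ length M) (∣p∪⁅x⁆∣≡1+∣p∣ I ℓ∉I)) (trans (cong suc tight) size)
    }
    where
    size = x∈p⇒1+∣p-x∣≡∣p∣ (V G) ℓ∈V
    open Tight (go f (G ∖ ℓ) (s≤s⁻¹ (subst (_≤ suc f) (sym size) V≤f)) (acyclic ∘ mapCycle proj₁))
    I-indep = proj₁ (∖⁻-Independent G independent)
    ℓ∉I = proj₂ (∖⁻-Independent G independent)
  ...   | yes (w , ℓ~w) = record
    { I = I ∪ ⁅ ℓ ⁆ ; M = (ℓ , w) ∷ M
    ; independent = insert-Independent G (proj₁ I-indep) ℓ∈V
        (λ u∈I ℓ~u → w∉I (subst (_∈ I) (one ℓ~u ℓ~w) u∈I))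
    ; matching = cons-Matching G ℓ~w matching
    ; tight = trans (cong (_+ suc (length M)) (∣p∪⁅x⁆∣≡1+∣p∣ I (proj₂ I-indep)))
        (trans (cong suc (trans (+-suc _ _) (trans (cong suc tight) size′))) size)
    }
    where
    size = x∈p⇒1+∣p-x∣≡∣p∣ (V G) ℓ∈V
    w∈V-ℓ = x∈p∧x≢y⇒x∈p-y (Adj⇒∈V G (Adj-sym G ℓ~w)) λ { refl → Adj-irrefl G ℓ~w }
    size′ = x∈p⇒1+∣p-x∣≡∣p∣ (V G - ℓ) w∈V-ℓ
    open Tight (go f (G ∖ ℓ ∖ w)
      (≤-trans (∣p─q∣≤∣p∣ (V G - ℓ) _) (s≤s⁻¹ (subst (_≤ suc f) (sym size) V≤f)))
      (acyclic ∘ mapCycle (proj₁ ∘ proj₁)))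
    I-indep′ = ∖⁻-Independent (G ∖ ℓ) independent
    w∉I = proj₂ I-indep′
    I-indep = ∖⁻-Independent G (proj₁ I-indep′)

-- Weak duality between independent sets and matchings.

Subset-Independent : (G : Graph n) {I J : Subset n} → Independent G I → J ⊆ I → Independent G J
Subset-Independent G (I⊆V , indep) J⊆I = (I⊆V ∘ J⊆I) , λ u∈ v∈ → indep (J⊆I u∈) (J⊆I v∈)

-- This amounts to d(A) ≤ |P| - 2|M|, since the partner of a matched vertex of `A` lies in N(A).
N-bound : (G : Graph n) {P A : Subset n} {M : List (Fin n × Fin n)} → A ⊆ P → Matching G M →
          All (λ (u , v) → u ∈ P × v ∈ P) M → ∣ A ∣ + (length M + length M) ≤ ∣ P ∣ + ∣ N G A ∣
N-bound G {P} {A} {M} A⊆P (es , ds) ⊆P = matching-bound M A P (N G A) A⊆P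
  (All.zipWith (λ (u~v , uv∈P) →
    (λ { refl → Adj-irrefl G u~v }) , uv∈P ,
    (λ u∈A → N⁺ G A u∈A u~v) , (λ v∈A → N⁺ G A v∈A (Adj-sym G u~v)))
    (es , ⊆P))
  ds

edges⊆V : (G : Graph n) {M : List (Fin n × Fin n)} → Matching G M →
          All (λ (u , v) → u ∈ V G × v ∈ V G) M
edges⊆V G (es , _) = All.map (λ u~v → Adj⇒∈V G u~v , Adj⇒∈V G (Adj-sym G u~v)) es

∣I∣+∣N∣≤∣V∣ : (G : Graph n) {I : Subset n} → Independent G I → ∣ I ∣ + ∣ N G I ∣ ≤ ∣ V G ∣
∣I∣+∣N∣≤∣V∣ G {I} (I⊆V , indep) = subst (_≤ ∣ V G ∣)
  (Disjoint⇒∣p∪q∣≡∣p∣+∣q∣ I (N G I) λ v∈I v∈N →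
    let u , u∈I , u~v = N⁻ G I v∈N in indep u∈I v∈I u~v)
  (p⊆q⇒∣p∣≤∣q∣ {p = I ∪ N G I} {q = V G} ⊆V)
  where
  ⊆V : I ∪ N G I ⊆ V G
  ⊆V v∈ with x∈p∪q⁻ I (N G I) v∈
  ... | inj₁ v∈I = I⊆V v∈I
  ... | inj₂ v∈N = let u , _ , u~v = N⁻ G I v∈N in Adj⇒∈V G (Adj-sym G u~v)

m+m≤n+n⇒m≤n : m + m ≤ n + n → m ≤ n
m+m≤n+n⇒m≤n le = ≮⇒≥ λ n<m → <⇒≱ (+-mono-< n<m n<m) le

-- Adding `N-bound` for P = V(G) to `∣I∣+∣N∣≤∣V∣` cancels |N(I)| and leaves twice the claim.
weak-duality : (G : Graph n) {I : Subset n} {M : List (Fin n × Fin n)} →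
               Independent G I → Matching G M → ∣ I ∣ + length M ≤ ∣ V G ∣
weak-duality G {I} {M} I-indep@(I⊆V , _) M-matching = m+m≤n+n⇒m≤n (begin
  (i + μ) + (i + μ)      ≡⟨ shuffle i μ ⟩
  i + (i + (μ + μ))      ≤⟨ +-monoʳ-≤ i (N-bound G I⊆V M-matching (edges⊆V G M-matching)) ⟩
  i + (∣ V G ∣ + ν)      ≡⟨ shuffle′ i ∣ V G ∣ ν ⟩
  ∣ V G ∣ + (i + ν)      ≤⟨ +-monoʳ-≤ ∣ V G ∣ (∣I∣+∣N∣≤∣V∣ G I-indep) ⟩
  ∣ V G ∣ + ∣ V G ∣      ∎)
  where
  open ≤-Reasoning
  i = ∣ I ∣
  μ = length M
  ν = ∣ N G I ∣
  shuffle : ∀ i μ → (i + μ) + (i + μ) ≡ i + (i + (μ + μ))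
  shuffle = solve-∀
  shuffle′ : ∀ i v ν → i + (v + ν) ≡ v + (i + ν)
  shuffle′ = solve-∀

module _ (G : Graph n) {I : Subset n} {M : List (Fin n × Fin n)}
  (independent : Independent G I) (matching : Matching G M) (V≤I+M : ∣ V G ∣ ≤ ∣ I ∣ + length M) where

  tight⇒maximum : MaximumIndependent G I
  tight⇒maximum = independent , λ S S-indep →
    +-cancelʳ-≤ (length M) _ _ (≤-trans (weak-duality G S-indep matching) V≤I+M)

  tight⇒KönigEgerváry : KönigEgerváry G
  tight⇒KönigEgerváry = _ , _ , (I , tight⇒maximum , refl) ,
    (M , (matching , λ M′ M′-matching →
      +-cancelˡ-≤ ∣ I ∣ _ _ (≤-trans (weak-duality G independent M′-matching) V≤I+M)) , refl) ,
    ≤-antisym (weak-duality G independent matching) V≤I+M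

-- Critical independent sets, kernel and core.

≤-rebalance⁺ : ∀ a b c e → ℤ.+ a ℤ.- ℤ.+ b ℤ.≤ ℤ.+ c ℤ.- ℤ.+ e → a + e ≤ c + b
≤-rebalance⁺ a b c e le = ℤ.drop‿+≤+ (subst₂ ℤ._≤_ (lhs (ℤ.+ a) (ℤ.+ b) (ℤ.+ e)) (rhs (ℤ.+ c) (ℤ.+ e) (ℤ.+ b))
  (ℤ.+-monoˡ-≤ (ℤ.+ b ℤ.+ ℤ.+ e) le))
  where
  lhs : ∀ a b e → a ℤ.- b ℤ.+ (b ℤ.+ e) ≡ a ℤ.+ e
  lhs = ℤ-solve-∀
  rhs : ∀ c e b → c ℤ.- e ℤ.+ (b ℤ.+ e) ≡ c ℤ.+ b
  rhs = ℤ-solve-∀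

≤-rebalance⁻ : ∀ a b c e → a + e ≤ c + b → ℤ.+ a ℤ.- ℤ.+ b ℤ.≤ ℤ.+ c ℤ.- ℤ.+ e
≤-rebalance⁻ a b c e le = subst₂ ℤ._≤_ (lhs (ℤ.+ a) (ℤ.+ b) (ℤ.+ e)) (rhs (ℤ.+ c) (ℤ.+ e) (ℤ.+ b))
  (ℤ.+-monoˡ-≤ (ℤ.- (ℤ.+ b ℤ.+ ℤ.+ e)) (ℤ.+≤+ le))
  where
  lhs : ∀ a b e → a ℤ.+ e ℤ.- (b ℤ.+ e) ≡ a ℤ.- b
  lhs = ℤ-solve-∀
  rhs : ∀ c e b → c ℤ.+ b ℤ.- (b ℤ.+ e) ≡ c ℤ.- e
  rhs = ℤ-solve-∀

module _ (G : Graph n) {S : Subset n} (S-max : MaximumIndependent G S) where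

  -- With R = J ─ S, exchanging S ∩ N(R) for R in the maximum set S shows |R| ≤ |S ∩ N(R)|,
  -- and S ∩ N(R) is a part of N(J) that misses N(J ∩ S).
  d≤d-∩-maximum : ∀ J → Independent G J → d G J ℤ.≤ d G (J ∩ S)
  d≤d-∩-maximum J J-indep = ≤-rebalance⁻ (∣ J ∣) (∣ N G J ∣) _ _ (begin
    ∣ J ∣ + ν              ≡⟨ cong (_+ ν) (∣p∩q∣+∣p─q∣≡∣p∣ J S) ⟨
    (j + ∣ R ∣) + ν        ≡⟨ shuffle j ∣ R ∣ ν ⟩
    j + (ν + ∣ R ∣)        ≤⟨ +-monoʳ-≤ j (+-monoʳ-≤ ν ∣R∣≤) ⟩
    j + (ν + ∣ S ∩ N G R ∣) ≡⟨ cong (j +_) (Disjoint⇒∣p∪q∣≡∣p∣+∣q∣ _ _ disjoint) ⟨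
    j + ∣ N G (J ∩ S) ∪ (S ∩ N G R) ∣ ≤⟨ +-monoʳ-≤ j (p⊆q⇒∣p∣≤∣q∣ {p = N G (J ∩ S) ∪ (S ∩ N G R)} ⊆NJ) ⟩
    j + ∣ N G J ∣ ∎)
    where
    open ≤-Reasoning
    S-indep = proj₁ S-max
    R = J ─ S
    j = ∣ J ∩ S ∣
    ν = ∣ N G (J ∩ S) ∣
    shuffle : ∀ a b c → (a + b) + c ≡ a + (c + b)
    shuffle = solve-∀
    exchange : Independent G ((S ─ N G R) ∪ R)
    exchange = ∪-Independent G (Subset-Independent G S-indep (p─q⊆p S (N G R)))
      (Subset-Independent G J-indep (p─q⊆p J S))
      λ u∈ v∈R u~v → proj₂ (x∈p─q⁻ S (N G R) u∈) (N⁺ G R v∈R (Adj-sym G u~v))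
    ∣R∣≤ : ∣ R ∣ ≤ ∣ S ∩ N G R ∣
    ∣R∣≤ = +-cancelʳ-≤ ∣ S ─ N G R ∣ _ _ (begin
      ∣ R ∣ + ∣ S ─ N G R ∣            ≡⟨ +-comm ∣ R ∣ _ ⟩
      ∣ S ─ N G R ∣ + ∣ R ∣            ≡⟨ Disjoint⇒∣p∪q∣≡∣p∣+∣q∣ _ R (λ v∈ v∈R → proj₂ (x∈p─q⁻ J S v∈R) (p─q⊆p S (N G R) v∈)) ⟨
      ∣ (S ─ N G R) ∪ R ∣              ≤⟨ proj₂ S-max _ exchange ⟩
      ∣ S ∣                            ≡⟨ ∣p∩q∣+∣p─q∣≡∣p∣ S (N G R) ⟨
      ∣ S ∩ N G R ∣ + ∣ S ─ N G R ∣    ∎)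
    disjoint : Disjoint (N G (J ∩ S)) (S ∩ N G R)
    disjoint v∈N v∈ =
      let u , u∈ , u~v = N⁻ G (J ∩ S) v∈N
      in proj₂ S-indep (p∩q⊆q J S u∈) (p∩q⊆p S _ v∈) u~v
    ⊆NJ : N G (J ∩ S) ∪ (S ∩ N G R) ⊆ N G J
    ⊆NJ v∈ with x∈p∪q⁻ (N G (J ∩ S)) _ v∈
    ... | inj₁ v∈N = let u , u∈ , u~v = N⁻ G (J ∩ S) v∈N in N⁺ G J (p∩q⊆p J S u∈) u~v
    ... | inj₂ v∈′ = let u , u∈ , u~v = N⁻ G R (p∩q⊆q S _ v∈′) in N⁺ G J (p─q⊆p J S u∈) u~v

  ∩-maximum-Critical : ∀ {A} → CriticalIndependent G A → CriticalIndependent G (A ∩ S)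
  ∩-maximum-Critical {A} (A-indep , A-crit) =
    Subset-Independent G A-indep (p∩q⊆p A S) ,
    λ J J-indep → ℤ.≤-trans (A-crit J J-indep) (d≤d-∩-maximum A A-indep)

argmax : (f : Subset n → ℤ) → ∃ λ X → ∀ Y → f Y ℤ.≤ f X
argmax {zero}  f = [] , λ { [] → ℤ.≤-refl }
argmax {suc n} f with argmax (f ∘ (true ∷_)) | argmax (f ∘ (false ∷_))
... | X , X-max | X′ , X′-max with ℤ.≤-total (f (true ∷ X)) (f (false ∷ X′))
...   | inj₁ le = false ∷ X′ , λ
  { (true ∷ Y) → ℤ.≤-trans (X-max Y) le ; (false ∷ Y) → X′-max Y }
...   | inj₂ ge = true ∷ X , λ
  { (true ∷ Y) → X-max Y ; (false ∷ Y) → ℤ.≤-trans (X′-max Y) ge }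

-- It suffices to exhibit one critical set inside `S`. Maximising d over the subsets X ∩ S gives
-- one, since by `d≤d-∩-maximum` no independent set does better than its trace on `S`.
ker⊆core : (G : Graph n) → ker G U.⊆ core G
ker⊆core G v∈ker S S-max =
  let X , X-max = argmax λ X → d G (X ∩ S)
  in p∩q⊆q X S (v∈ker (X ∩ S)
       ( Subset-Independent G (proj₁ S-max) (p∩q⊆q X S)
       , λ J J-indep → ℤ.≤-trans (d≤d-∩-maximum G S-max J J-indep) (X-max J)))

-- The core of a forest lies in its kernel.

private
  -- The hypotheses add up to 2s ≤ 2s′ + 1, and parity does the rest. Here a = |A|, ν = |N(A)|, σ =
  -- |N(S)|, s = α(G), and s′ and μ are the sizes of a tight pair of G - v.
  core⊆ker-arith : ∀ {a ν σ μ s s′} → a + (μ + μ) ≤ (s′ + μ) + ν → s + ν ≤ a + σ →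
                   s + σ ≤ suc (s′ + μ) → s ≤ s′
  core⊆ker-arith {a} {ν} {σ} {μ} {s} {s′} p q r = ≮⇒≥ λ s′<s → 1+n≰n (begin
    suc (suc (s′ + s′))  ≡⟨ cong suc (+-suc s′ s′) ⟨
    suc s′ + suc s′      ≤⟨ +-mono-≤ s′<s s′<s ⟩
    s + s                ≤⟨ +-cancelˡ-≤ (a + ν + σ + μ + μ) _ _ (begin
      a + ν + σ + μ + μ + (s + s)                    ≡⟨ lhs a ν σ μ s ⟩
      a + (μ + μ) + (s + ν) + (s + σ)                ≤⟨ +-mono-≤ (+-mono-≤ p q) r ⟩
      s′ + μ + ν + (a + σ) + suc (s′ + μ)            ≡⟨ rhs a ν σ μ s′ ⟩
      a + ν + σ + μ + μ + suc (s′ + s′)              ∎) ⟩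
    suc (s′ + s′)        ∎)
    where
    open ≤-Reasoning
    lhs : ∀ a ν σ μ s → a + ν + σ + μ + μ + (s + s) ≡ a + (μ + μ) + (s + ν) + (s + σ)
    lhs = solve-∀
    rhs : ∀ a ν σ μ s → s + μ + ν + (a + σ) + suc (s + μ) ≡ a + ν + σ + μ + μ + suc (s + s)
    rhs = solve-∀

-- If v lay outside a critical set A, then d(A) ≤ |V ∖ v| - 2 μ(G ∖ v), while v ∈ core(G) makes
-- α(G ∖ v) < α(G), so that this bound is smaller than d(S) for a maximum independent set S.
acyclic⇒core⊆ker : (G : Graph n) → ¬ Cycle G → core G U.⊆ ker G
acyclic⇒core⊆ker G acyclic {v} v∈core A ((A⊆V , _) , A-crit) =
  decidable-stable (v ∈? A) λ v∉A →
    -- `S⊀S′` says |S.I| ≤ |S′.I|, so `S′.I` is maximum in G although it avoids the core vertex v.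
    let S⊀S′ = core⊆ker-arith {s = ∣ S.I ∣} {s′ = ∣ S′.I ∣} (bound v∉A)
                 (≤-rebalance⁺ (∣ S.I ∣) (∣ N G S.I ∣) (∣ A ∣) (∣ N G A ∣) (A-crit S.I S.independent))
                 (subst (∣ S.I ∣ + ∣ N G S.I ∣ ≤_) (trans (sym size) (cong suc (sym S′.tight)))
                   (∣I∣+∣N∣≤∣V∣ G S.independent))
    in proj₂ S′-indep (v∈core S′.I (proj₁ S′-indep , λ X X-indep → ≤-trans (proj₂ S-max X X-indep) S⊀S′))
  where
  module S  = Tight (acyclic⇒Tight G acyclic)
  module S′ = Tight (acyclic⇒Tight (G ∖ v) (acyclic ∘ mapCycle proj₁))
  S-max : MaximumIndependent G S.I
  S-max = tight⇒maximum G S.independent S.matching (≤-reflexive (sym S.tight))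
  S′-indep : Independent G S′.I × v ∉ S′.I
  S′-indep = ∖⁻-Independent G S′.independent
  size : suc ∣ V G - v ∣ ≡ ∣ V G ∣
  size = x∈p⇒1+∣p-x∣≡∣p∣ (V G) (proj₁ (proj₁ S-max) (v∈core S.I S-max))
  bound : v ∉ A → ∣ A ∣ + (length S′.M + length S′.M) ≤ (∣ S′.I ∣ + length S′.M) + ∣ N G A ∣
  bound v∉A = subst (λ c → ∣ A ∣ + (length S′.M + length S′.M) ≤ c + ∣ N G A ∣) (sym S′.tight)
    (N-bound G (λ u∈A → x∈p∧x≢y⇒x∈p-y (A⊆V u∈A) λ { refl → v∉A u∈A })
      (map-Matching (G ∖ v) G proj₁ S′.matching) (edges⊆V (G ∖ v) S′.matching))

-- Non-König-Egerváry graphs with a forest G - y.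

module _ (G : Graph n) (x~y : Adj G x y) (¬KE : ¬ KönigEgerváry G) (acyclic : ¬ Cycle (G ∖ y)) where

  -- In a tight pair (I , M) of G ∖ y ∖ x the set I is maximum in G: a larger independent set
  -- would be tight together with the matching M ∪ {xy} of G.
  maximum-avoiding-edge : ∃ λ I → MaximumIndependent G I × x ∉ I × y ∉ I
  maximum-avoiding-edge = I , (proj₁ I-indep , I-max) , proj₂ I-indep′ , proj₂ I-indep
    where
    open Tight (acyclic⇒Tight (G ∖ y ∖ x) (acyclic ∘ mapCycle proj₁))
    I-indep′ = ∖⁻-Independent (G ∖ y) independent
    I-indep  = ∖⁻-Independent G (proj₁ I-indep′)
    size : 2 + (∣ I ∣ + length M) ≡ ∣ V G ∣
    size = trans (cong (2 +_) tight)
      (trans (cong suc (x∈p⇒1+∣p-x∣≡∣p∣ (V G - y)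
          (x∈p∧x≢y⇒x∈p-y (Adj⇒∈V G x~y) λ { refl → Adj-irrefl G x~y })))
        (x∈p⇒1+∣p-x∣≡∣p∣ (V G) (Adj⇒∈V G (Adj-sym G x~y))))
    I-max : ∀ S → Independent G S → ∣ S ∣ ≤ ∣ I ∣
    I-max S S-indep = ≮⇒≥ λ I<S → ¬KE (tight⇒KönigEgerváry G S-indep
      (cons-Matching G (Adj-sym G x~y) matching)
      (subst₂ _≤_ size (sym (+-suc ∣ S ∣ (length M))) (s≤s (+-monoˡ-≤ (length M) I<S))))

-- Unicyclic graphs and their cycle.

module _ (G : Graph n) (U : Unicyclic G) where

  open Unicyclic U
  private C = cycle

  VertexOf? : U.Decidable (VertexOf C)
  VertexOf? v = any? λ i → Cycle.vertex C i ≟ v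

  cycle-neighbour : VertexOf C y → ∃ λ z → EdgeOf C y z × Adj G y z
  cycle-neighbour (i , refl) =
    let j , i↝j = successor i
    in Cycle.vertex C j , (i , j , i↝j , inj₁ (refl , refl)) , Cycle.adjacent C i↝j

  EdgeOf⇒VertexOf : (D : Cycle G) → EdgeOf D u v → VertexOf D u × VertexOf D v
  EdgeOf⇒VertexOf D (i , j , _ , inj₁ (eq , eq′)) = (i , eq) , (j , eq′)
  EdgeOf⇒VertexOf D (i , j , _ , inj₂ (eq , eq′)) = (j , eq′) , (i , eq)

  -- A cycle of G - y is a cycle of G, hence has the edges of `C`, one of which ends at the deleted
  -- vertex y.
  acyclic-∖ : VertexOf C y → ¬ Cycle (G ∖ y)
  acyclic-∖ y∈C D =
    let _ , yz∈C , _ = cycle-neighbour y∈C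
        i , eq       = proj₁ (EdgeOf⇒VertexOf (mapCycle proj₁ D) (proj₂ (unique (mapCycle proj₁ D)) yz∈C))
        _ , i↝j      = successor i
    in proj₁ (proj₂ (Cycle.adjacent D i↝j)) eq

  core∩C≡∅ : ¬ KönigEgerváry G → core G v → ¬ VertexOf C v
  core∩C≡∅ ¬KE v∈core v∈C =
    let _ , _ , v~z          = cycle-neighbour v∈C
        I , I-max , _ , v∉I = maximum-avoiding-edge G (Adj-sym G v~z) ¬KE (acyclic-∖ v∈C)
    in v∉I (v∈core I I-max)

  -- Cutting G along an edge xy that hangs T_x on the cycle.

  module _ (x~y : Adj G x y) (x∉C : ¬ VertexOf C x) (y∈C : VertexOf C y) where

    private
      D = deleteEdge G x y
      T′ = T G C x y
      W = V T′

    W⁺ : v ∈ V G → Star (Adj D) x v → v ∈ W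
    W⁺ v∈V x⟶v = subsetOf⁺ (λ v → v ∈? V D ×-dec reachable? D x v) (v∈V , x⟶v)

    W⁻ : v ∈ W → v ∈ V G × Star (Adj D) x v
    W⁻ = subsetOf⁻ (λ v → v ∈? V D ×-dec reachable? D x v)

    -- A path from x to y in G - xy would close up to a cycle through the edge xy.
    y∉W : y ∉ W
    y∉W y∈W with Star⇒Path (Adj D) (proj₂ (W⁻ y∈W))
    ... | 0 , [] = Adj-irrefl G x~y
    ... | 1 , cons (_ , ≢xy) [] _ = ≢xy (inj₁ (refl , refl))
    ... | suc (suc m) , p =
      -- By uniqueness the edge yx of `D′` is an edge of `C`, which puts x on `C`.
      x∉C (proj₂ (EdgeOf⇒VertexOf C (proj₁ (unique D′) yx∈D′)))
      where
      D′ : Cycle G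
      D′ = closePath (Adj D) G proj₁ p (Adj-sym G x~y)
      yx∈D′ : EdgeOf D′ y x
      yx∈D′ = _ , _ , wrap , inj₁ (at-last (Adj D) p , at-first (Adj D) p)

    -- Any other edge survives in G - xy and prolongs a walk from x; the orientation with u = y is
    -- excluded by `y∉W`.
    leaving-W : u ∈ W → Adj G u v → v ∈ W ⊎ (u ≡ x × v ≡ y)
    leaving-W {u} {v} u∈W u~v with u ≟ x | v ≟ y
    ... | yes u≡x | yes v≡y = inj₂ (u≡x , v≡y)
    ... | no u≢x | _ = inj₁ (W⁺ (Adj⇒∈V G (Adj-sym G u~v)) (proj₂ (W⁻ u∈W) ◅◅ ((u~v , λ
      { (inj₁ (u≡x , _)) → u≢x u≡x ; (inj₂ (refl , _)) → y∉W u∈W }) ◅ ε)))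
    ... | yes _ | no v≢y = inj₁ (W⁺ (Adj⇒∈V G (Adj-sym G u~v)) (proj₂ (W⁻ u∈W) ◅◅ ((u~v , λ
      { (inj₁ (_ , v≡y)) → v≢y v≡y ; (inj₂ (refl , _)) → y∉W u∈W }) ◅ ε)))

    T-adj : u ∈ W → v ∈ W → Adj G u v → Adj T′ u v
    T-adj u∈W v∈W u~v =
      (u~v , λ { (inj₁ (_ , refl)) → y∉W v∈W ; (inj₂ (refl , _)) → y∉W u∈W }) , u∈W , v∈W

    -- `W` misses y, so T_x is a subgraph of the forest G - y.
    acyclic-T : ¬ Cycle T′
    acyclic-T D′ = acyclic-∖ y∈C (mapCycle
      (λ ((u~v , _) , u∈W , v∈W) →
        u~v , (λ { refl → y∉W u∈W }) , (λ { refl → y∉W v∈W })) D′)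

    T-Independent⁺ : ∀ {J} → Independent G J → J ⊆ W → Independent T′ J
    T-Independent⁺ (_ , indep) J⊆W = J⊆W , λ u∈ v∈ u~v → indep u∈ v∈ (proj₁ (proj₁ u~v))

    T-Independent⁻ : ∀ {J} → Independent T′ J → Independent G J
    T-Independent⁻ (J⊆W , indep) =
      (proj₁ ∘ W⁻ ∘ J⊆W) , λ u∈ v∈ u~v → indep u∈ v∈ (T-adj (J⊆W u∈) (J⊆W v∈) u~v)

    module _ {X Z : Subset n} (X⊆W : X ⊆ W) (x∉X : x ∉ X) (Z∩W≡∅ : Disjoint Z W) (y∉Z : y ∉ Z) where

      -- Only xy leaves `W`. As x is not in `X`, all neighbours of `X` stay in `W`; as y is not in
      -- `Z`, no neighbour of `Z` lies in `W`.
      ∣N[X∪Z]∣ : ∣ N G (X ∪ Z) ∣ ≡ ∣ N T′ X ∣ + ∣ N G Z ∣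
      ∣N[X∪Z]∣ = trans (cong ∣_∣ (⊆-antisym fwd bwd)) (Disjoint⇒∣p∪q∣≡∣p∣+∣q∣ _ _ disjoint)
        where
        fwd : N G (X ∪ Z) ⊆ N T′ X ∪ N G Z
        fwd v∈ with N⁻ G (X ∪ Z) v∈
        ... | u , u∈ , u~v with x∈p∪q⁻ X Z u∈
        ...   | inj₂ u∈Z = q⊆p∪q (N T′ X) _ (N⁺ G Z u∈Z u~v)
        ...   | inj₁ u∈X with leaving-W (X⊆W u∈X) u~v
        ...     | inj₁ v∈W        = p⊆p∪q (N G Z) (N⁺ T′ X u∈X (T-adj (X⊆W u∈X) v∈W u~v))
        ...     | inj₂ (refl , _) = ⊥-elim (x∉X u∈X)
        bwd : N T′ X ∪ N G Z ⊆ N G (X ∪ Z)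
        bwd v∈ with x∈p∪q⁻ (N T′ X) (N G Z) v∈
        ... | inj₁ v∈N = let u , u∈X , (u~v , _) , _ = N⁻ T′ X v∈N in N⁺ G (X ∪ Z) (p⊆p∪q Z u∈X) u~v
        ... | inj₂ v∈N = let u , u∈Z , u~v = N⁻ G Z v∈N in N⁺ G (X ∪ Z) (q⊆p∪q X Z u∈Z) u~v
        disjoint : Disjoint (N T′ X) (N G Z)
        disjoint v∈N v∈N′ with N⁻ T′ X v∈N | N⁻ G Z v∈N′
        ... | _ , _ , (_ , _ , v∈W) | u , u∈Z , u~v with leaving-W v∈W (Adj-sym G u~v)
        ...   | inj₁ u∈W        = Z∩W≡∅ u∈Z u∈W
        ...   | inj₂ (_ , refl) = y∉Z u∈Z

    module _ {I : Subset n} (I-max : MaximumIndependent G I) (x∉I : x ∉ I) (y∉I : y ∉ I) where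

      -- The only edge that could join the two parts is xy, and y is not in `I`.
      graft-Independent : ∀ {S} → Independent T′ S → Independent G (S ∪ (I ─ W))
      graft-Independent S-indep = ∪-Independent G (T-Independent⁻ S-indep)
        (Subset-Independent G (proj₁ I-max) (p─q⊆p I W))
        λ u∈S v∈ u~v → no-edge (leaving-W (proj₁ S-indep u∈S) u~v) v∈
        where
        no-edge : v ∈ W ⊎ (u ≡ x × v ≡ y) → v ∉ I ─ W
        no-edge (inj₁ v∈W)        v∈ = proj₂ (x∈p─q⁻ I W v∈) v∈W
        no-edge (inj₂ (_ , refl)) v∈ = y∉I (p─q⊆p I W v∈)

      ∣graft∣ : ∀ {S} → Independent T′ S → ∣ S ∪ (I ─ W) ∣ ≡ ∣ S ∣ + ∣ I ─ W ∣
      ∣graft∣ (S⊆W , _) = Disjoint⇒∣p∪q∣≡∣p∣+∣q∣ _ _ λ u∈S u∈ → proj₂ (x∈p─q⁻ I W u∈) (S⊆W u∈S)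

      I∩W-indep : Independent T′ (I ∩ W)
      I∩W-indep = T-Independent⁺ (Subset-Independent G (proj₁ I-max) (p∩q⊆p I W)) (p∩q⊆q I W)

      I∩W-maximum : MaximumIndependent T′ (I ∩ W)
      I∩W-maximum = I∩W-indep , λ S S-indep → +-cancelʳ-≤ ∣ I ─ W ∣ _ _ (begin
        ∣ S ∣ + ∣ I ─ W ∣      ≡⟨ ∣graft∣ S-indep ⟨
        ∣ S ∪ (I ─ W) ∣        ≤⟨ proj₂ I-max _ (graft-Independent S-indep) ⟩
        ∣ I ∣                  ≡⟨ ∣p∩q∣+∣p─q∣≡∣p∣ I W ⟨
        ∣ I ∩ W ∣ + ∣ I ─ W ∣  ∎)
        where open ≤-Reasoning

      graft-maximum : ∀ {S} → MaximumIndependent T′ S → MaximumIndependent G (S ∪ (I ─ W))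
      graft-maximum {S} (S-indep , S-max) = graft-Independent S-indep , λ S′ S′-indep → begin
        ∣ S′ ∣                 ≤⟨ proj₂ I-max S′ S′-indep ⟩
        ∣ I ∣                  ≡⟨ ∣p∩q∣+∣p─q∣≡∣p∣ I W ⟨
        ∣ I ∩ W ∣ + ∣ I ─ W ∣  ≤⟨ +-monoˡ-≤ ∣ I ─ W ∣ (S-max _ I∩W-indep) ⟩
        ∣ S ∣ + ∣ I ─ W ∣      ≡⟨ ∣graft∣ S-indep ⟨
        ∣ S ∪ (I ─ W) ∣        ∎
        where open ≤-Reasoning

      core∩W⊆core-T : core G v → v ∈ W → core T′ v
      core∩W⊆core-T v∈core v∈W S S-max with x∈p∪q⁻ S (I ─ W) (v∈core _ (graft-maximum S-max))
      ... | inj₁ v∈S = v∈S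
      ... | inj₂ v∈  = ⊥-elim (proj₂ (x∈p─q⁻ I W v∈) v∈W)

      -- Replacing A ∩ W by J ∩ I, for J independent in T, keeps A inside I and away from xy, so
      -- that d splits over W and its complement.
      Critical-∩W : ∀ {A} → A ⊆ I → CriticalIndependent G A → CriticalIndependent T′ (A ∩ W)
      Critical-∩W {A} A⊆I (A-indep , A-crit) =
        T-Independent⁺ (Subset-Independent G A-indep (p∩q⊆p A W)) (p∩q⊆q A W) ,
        -- Passing from J to its trace on `I ∩ W` does not lower d in T_x, and makes the union with
        -- `Z` a subset of `I`, hence independent in G.
        λ J J-indep → ℤ.≤-trans (d≤d-∩-maximum T′ I∩W-maximum J J-indep)
          (≤-rebalance⁻ (∣ J ∩ (I ∩ W) ∣) (∣ N T′ (J ∩ (I ∩ W)) ∣) (∣ A ∩ W ∣) (∣ N T′ (A ∩ W) ∣)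
            (compare (J ∩ (I ∩ W)) (p∩q⊆q J (I ∩ W))))
        where
        open ≤-Reasoning
        Z = A ─ W
        Z∩W≡∅ : Disjoint Z W
        Z∩W≡∅ = proj₂ ∘ x∈p─q⁻ A W
        Z⊆I : Z ⊆ I
        Z⊆I = A⊆I ∘ p─q⊆p A W
        A≡ : A ≡ (A ∩ W) ∪ Z
        A≡ = ⊆-antisym split join
          where
          split : A ⊆ (A ∩ W) ∪ Z
          split {u} u∈A with u ∈? W
          ... | yes u∈W = p⊆p∪q Z (x∈p∩q⁺ (u∈A , u∈W))
          ... | no  u∉W = q⊆p∪q (A ∩ W) Z (x∈p∧x∉q⇒x∈p─q u∈A u∉W)
          join : (A ∩ W) ∪ Z ⊆ A
          join u∈ with x∈p∪q⁻ (A ∩ W) Z u∈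
          ... | inj₁ u∈′ = p∩q⊆p A W u∈′
          ... | inj₂ u∈Z = p─q⊆p A W u∈Z
        shuffle : ∀ a b c e → (a + e) + (b + c) ≡ (a + b) + (e + c)
        shuffle = solve-∀
        compare : ∀ K → K ⊆ I ∩ W → ∣ K ∣ + ∣ N T′ (A ∩ W) ∣ ≤ ∣ A ∩ W ∣ + ∣ N T′ K ∣
        compare K K⊆ = +-cancelʳ-≤ (∣ Z ∣ + ∣ N G Z ∣) _ _ (begin
          -- In the
          (∣ K ∣ + ∣ N T′ (A ∩ W) ∣) + (∣ Z ∣ + ∣ N G Z ∣)  ≡⟨ shuffle (∣ K ∣) (∣ Z ∣) (∣ N G Z ∣) (∣ N T′ (A ∩ W) ∣) ⟩
          (∣ K ∣ + ∣ Z ∣) + (∣ N T′ (A ∩ W) ∣ + ∣ N G Z ∣)  ≡⟨ cong₂ _+_ (∣∪Z∣ K⊆W) (∣N∪Z∣ (p∩q⊆q A W) (A⊆I ∘ p∩q⊆p A W)) ⟨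
          ∣ K ∪ Z ∣ + ∣ N G ((A ∩ W) ∪ Z) ∣                 ≡⟨ cong (λ B → ∣ K ∪ Z ∣ + ∣ N G B ∣) A≡ ⟨
          ∣ K ∪ Z ∣ + ∣ N G A ∣                             ≤⟨ ≤-rebalance⁺ (∣ K ∪ Z ∣) (∣ N G (K ∪ Z) ∣) (∣ A ∣) (∣ N G A ∣)
                                                                (A-crit (K ∪ Z) (Subset-Independent G (proj₁ I-max) K∪Z⊆I)) ⟩
          ∣ A ∣ + ∣ N G (K ∪ Z) ∣                           ≡⟨ cong₂ _+_ (sym (∣p∩q∣+∣p─q∣≡∣p∣ A W)) (∣N∪Z∣ K⊆W K⊆I) ⟩
          (∣ A ∩ W ∣ + ∣ Z ∣) + (∣ N T′ K ∣ + ∣ N G Z ∣)    ≡⟨ shuffle (∣ A ∩ W ∣) (∣ Z ∣) (∣ N G Z ∣) (∣ N T′ K ∣) ⟨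
          (∣ A ∩ W ∣ + ∣ N T′ K ∣) + (∣ Z ∣ + ∣ N G Z ∣)    ∎)
          where
          K⊆W : K ⊆ W
          K⊆W = p∩q⊆q I W ∘ K⊆
          K⊆I : K ⊆ I
          K⊆I = p∩q⊆p I W ∘ K⊆
          ∣∪Z∣ : ∀ {B} → B ⊆ W → ∣ B ∪ Z ∣ ≡ ∣ B ∣ + ∣ Z ∣
          ∣∪Z∣ B⊆W = Disjoint⇒∣p∪q∣≡∣p∣+∣q∣ _ Z λ u∈B u∈Z → Z∩W≡∅ u∈Z (B⊆W u∈B)
          ∣N∪Z∣ : ∀ {B} → B ⊆ W → B ⊆ I → ∣ N G (B ∪ Z) ∣ ≡ ∣ N T′ B ∣ + ∣ N G Z ∣
          ∣N∪Z∣ B⊆W B⊆I = ∣N[X∪Z]∣ B⊆W (x∉I ∘ B⊆I) Z∩W≡∅ (y∉I ∘ Z⊆I)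
          K∪Z⊆I : K ∪ Z ⊆ I
          K∪Z⊆I u∈ with x∈p∪q⁻ K Z u∈
          ... | inj₁ u∈K = K⊆I u∈K
          ... | inj₂ u∈Z = Z⊆I u∈Z

      ker-T⊆ker : ker T′ U.⊆ ker G
      ker-T⊆ker v∈ker A A-crit =
        p∩q⊆p A I (p∩q⊆p (A ∩ I) W
          (v∈ker _ (Critical-∩W (p∩q⊆q A I) (∩-maximum-Critical G I-max A-crit))))

  first-cycle-vertex : ∀ {c} → Star (Adj G) v c → ¬ VertexOf C v → VertexOf C c →
    ∃₂ λ x y → Adj G x y × ¬ VertexOf C x × VertexOf C y × Star (Adj (deleteEdge G x y)) x v
  first-cycle-vertex ε v∉C c∈C = ⊥-elim (v∉C c∈C)
  first-cycle-vertex {v = v} (_◅_ {j = w} v~w w⟶c) v∉C c∈C with VertexOf? w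
  ... | yes w∈C = v , w , v~w , v∉C , w∈C , ε
  ... | no  w∉C =
    let x , y , x~y , x∉C , y∈C , x⟶w = first-cycle-vertex w⟶c w∉C c∈C
    in x , y , x~y , x∉C , y∈C , x⟶w ◅◅ ((Adj-sym G v~w , λ
      { (inj₁ (_ , v≡y)) → v∉C (subst (VertexOf C) (sym v≡y) y∈C)
      ; (inj₂ (w≡y , _)) → w∉C (subst (VertexOf C) (sym w≡y) y∈C) }) ◅ ε)

  module _ (¬KE : ¬ KönigEgerváry G) where

    ⋃kerT⊆ker : ⋃kerT G C U.⊆ ker G
    ⋃kerT⊆ker (x , y , (_ , x∉C , _) , x~y , y∈C , v∈ker) =
      let _ , I-max , x∉I , y∉I = maximum-avoiding-edge G x~y ¬KE (acyclic-∖ y∈C)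
      in ker-T⊆ker x~y x∉C y∈C I-max x∉I y∉I v∈ker

    core⊆⋃kerT : core G U.⊆ ⋃kerT G C
    core⊆⋃kerT {v} v∈core =
      let c∈C                   = zero , refl
          _ , _ , c~z           = cycle-neighbour c∈C
          J , J-max , _         = maximum-avoiding-edge G (Adj-sym G c~z) ¬KE (acyclic-∖ c∈C)
          v∈V                   = proj₁ (proj₁ J-max) (v∈core J J-max)
          x , y , x~y , x∉C , y∈C , x⟶v =
            first-cycle-vertex (connected v∈V (Adj⇒∈V G c~z)) (core∩C≡∅ ¬KE v∈core) c∈C
          _ , I-max , x∉I , y∉I = maximum-avoiding-edge G x~y ¬KE (acyclic-∖ y∈C)
          v∈core-T              = core∩W⊆core-T x~y x∉C y∈C I-max x∉I y∉I v∈core (W⁺ x~y x∉C y∈C v∈V x⟶v)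
      in x , y , (Adj⇒∈V G x~y , x∉C , y , x~y , y∈C) , x~y , y∈C ,
         acyclic⇒core⊆ker (T G C x y) (acyclic-T x~y x∉C y∈C) v∈core-T

theorem2p5 : ∀ {n : ℕ} (G : Graph n) (U : Unicyclic G) → ¬ KönigEgerváry G →
    (ker G ≐ ⋃kerT G (Unicyclic.cycle U)) × (⋃kerT G (Unicyclic.cycle U) ≐ core G)
theorem2p5 G U ¬KE =
  ((core⊆⋃kerT G U ¬KE ∘ ker⊆core G) , ⋃kerT⊆ker G U ¬KE) ,
  ((ker⊆core G ∘ ⋃kerT⊆ker G U ¬KE) , core⊆⋃kerT G U ¬KE)
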